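{- Let $q$ be a prime power, let $e\geq 2$, and let $R$ be a symplectic spread of $Sp(2e,q)$. Let $\Gamma_{q,e,R}$ be the graph obtained from $Sp(2e,q)$ by removing the edges of the cliques in the spread $R$. Then $\Gamma_{q,e,R}$ is a divisible design graph with parameters $$(v,k,\lambda_1,\lambda_2,m,n)=\left(\frac{q^{2e}-1}{q-1},\ q^e\,\frac{q^{e-1}-1}{q-1},\ q^e\,\frac{q^{e-2}-1}{q-1},\ \frac{(q^{e-1}-1)^2}{q-1},\ q^e+1,\ \frac{q^e-1}{q-1}\right).$$
   Context: A $k$-regular graph on $v$ vertices is a divisible design graph with parameters $(v,k,\lambda_1,\lambda_2,m,n)$ if its vertex set can be partitioned into $m$ classes of size $n$ such that any two distinct vertices from the same class have exactly $\lambda_1$ common neighbours and any two vertices from different classes have exactly $\lambda_2$ common neighbours. Let $\zeta$ be a symplectic polarity of $\mathrm{PG}(2e-1,q)$, i.e. a polarity with $x\in x^\zeta$ for every point $x$. The symplectic graph $Sp(2e,q)$ has the points of $\mathrm{PG}(2e-1,q)$ as vertices, two distinct points $x,y$ being adjacent iff $y\in x^\zeta$. A subspace $\pi$ is totally isotropic if $\pi\subseteq\pi^\zeta$. A symplectic spread is a set of totally isotropic subspaces of projective dimension $e-1$ partitioning the point set of $\mathrm{PG}(2e-1,q)$; it corresponds to a partition of the vertices of $Sp(2e,q)$ into $q^e+1$ cliques of order $(q^e-1)/(q-1)$. -}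

module Defs where

open import Level using (Level; 0ℓ; _⊔_) renaming (suc to ℓsuc)
open import Algebra.Apartness.Structures using (IsHeytingField)
open import Data.Fin.Base using (Fin)
open import Data.Nat.Base using (ℕ; _*_; _∸_; _^_; _<_; _≥_; NonZero; >-nonZero; nonTrivial⇒n>1)
open import Data.Nat.Primality using (Prime; prime⇒nonTrivial; prime⇒nonZero)
open import Data.Nat.Properties
  using (≤-trans; ^-monoʳ-≤; ^-identityʳ; m<n⇒0<n∸m; ≤-reflexive)
open import Data.Product.Base using (Σ; ∃-syntax; ∃₂; _×_; _,_; proj₁; proj₂)
open import Data.Vec.Base using (Vec; zipWith; map; replicate; foldr′)
open import Data.Vec.Relation.Unary.All using (All)
open import Function.Bundles using (Inverse; _↔_)
open import Relation.Binary.Bundles using (Setoid)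
open import Relation.Binary.Core using (Rel)
open import Relation.Binary.Definitions using (Symmetric; Irreflexive; _Respects_; _Respects₂_)
open import Relation.Binary.PropositionalEquality
  using (_≡_; _≢_; refl; sym; setoid)
import Relation.Binary.Construct.On as On
open import Relation.Nullary.Negation using (¬_)
open import Relation.Unary using (Pred; Decidable; _⊆_)
open import Relation.Unary.Relation.Binary.Equality using (≐-setoid)

PrimePower : ℕ → Set
PrimePower q = ∃₂ λ p h → Prime p × h ≥ 1 × q ≡ p ^ h

-- Only used to make division by q ∸ 1 meaningful.
primePower⇒q∸1-nonZero : ∀ {q} → PrimePower q → NonZero (q ∸ 1)
primePower⇒q∸1-nonZero (p , h , pr , h≥1 , refl) = >-nonZero (m<n⇒0<n∸m 1<q)
  where
  1<p : 1 < p
  1<p = nonTrivial⇒n>1 p {{prime⇒nonTrivial pr}}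

  1<q : 1 < p ^ h
  1<q = ≤-trans 1<p (≤-trans (≤-reflexive (sym (^-identityʳ p)))
                             (^-monoʳ-≤ p {{prime⇒nonZero pr}} h≥1))

-- With _≢_ as apartness, a Heyting field is a field in the usual sense:
-- every difference x - y with x ≢ y is invertible, and 1# ≢ 0#.
record FiniteField (q : ℕ) : Set₁ where
  infix  8 -_
  infixl 7 _·_
  infixl 6 _⊞_
  field
    Carrier        : Set
    _⊞_            : Carrier → Carrier → Carrier
    _·_            : Carrier → Carrier → Carrier
    -_             : Carrier → Carrier
    0#             : Carrier
    1#             : Carrier
    isHeytingField : IsHeytingField _≡_ _≢_ _⊞_ _·_ -_ 0# 1#
    order          : Carrier ↔ Fin q

HasSize : ∀ {a ℓ} → Setoid a ℓ → ℕ → Set (a ⊔ ℓ)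
HasSize S n = Inverse S (setoid (Fin n))

subsetoid : ∀ {a ℓ p} (S : Setoid a ℓ) → Pred (Setoid.Carrier S) p → Setoid (a ⊔ p) ℓ
subsetoid S P = On.setoid {B = Σ (Setoid.Carrier S) P} S proj₁

record Graph (a ℓ r : Level) : Set (ℓsuc (a ⊔ ℓ ⊔ r)) where
  field
    vertices : Setoid a ℓ

  open Setoid vertices public using () renaming (Carrier to Vertex; _≈_ to _≈ᵛ_)

  field
    Adj        : Rel Vertex r
    adj-resp   : Adj Respects₂ _≈ᵛ_
    adj-sym    : Symmetric Adj
    adj-irrefl : Irreflexive _≈ᵛ_ Adj

  Neighbours : Vertex → Setoid (a ⊔ r) ℓ
  Neighbours x = subsetoid vertices (Adj x)

  CommonNeighbours : Vertex → Vertex → Setoid (a ⊔ r) ℓ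
  CommonNeighbours x y = subsetoid vertices (λ z → Adj x z × Adj y z)

record IsDivisibleDesignGraph {a ℓ r} (G : Graph a ℓ r) (v k λ₁ λ₂ m n : ℕ)
       : Set (a ⊔ ℓ ⊔ r) where
  open Graph G
  field
    order          : HasSize vertices v
    regular        : ∀ x → HasSize (Neighbours x) k
    -- The partition consists of the fibres of class.
    class          : Vertex → Fin m
    class-cong     : ∀ {x y} → x ≈ᵛ y → class x ≡ class y
    class-size     : ∀ i → HasSize (subsetoid vertices (λ x → class x ≡ i)) n
    same-class     : ∀ x y → ¬ (x ≈ᵛ y) → class x ≡ class y →
                     HasSize (CommonNeighbours x y) λ₁
    distinct-class : ∀ x y → class x ≢ class y →
                     HasSize (CommonNeighbours x y) λ₂

module _ {q : ℕ} (F : FiniteField q) where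
  open FiniteField F using (_⊞_; _·_; 0#) renaming (Carrier to K)

  infixl 6 _+ᵛ_
  infixl 7 _·ᵛ_

  _+ᵛ_ : ∀ {d} → Vec K d → Vec K d → Vec K d
  _+ᵛ_ = zipWith _⊞_

  _·ᵛ_ : ∀ {d} → K → Vec K d → Vec K d
  c ·ᵛ v = map (c ·_) v

  0ᵛ : ∀ {d} → Vec K d
  0ᵛ = replicate _ 0#

  linComb : ∀ {d r} → Vec K r → Vec (Vec K d) r → Vec K d
  linComb cs bs = foldr′ _+ᵛ_ 0ᵛ (zipWith _·ᵛ_ cs bs)

  -- The subspaces of F^d are the subspaces of PG(d-1,q). Membership is decidable:
  -- the ambient space is finite, so classically this excludes nothing.
  record Subspace (d : ℕ) : Set₁ where
    field
      Member   : Pred (Vec K d) 0ℓ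
      member?  : Decidable Member
      0-closed : Member 0ᵛ
      +-closed : ∀ {u v} → Member u → Member v → Member (u +ᵛ v)
      ·-closed : ∀ c {v} → Member v → Member (c ·ᵛ v)

  open Subspace public using (Member)

  infix 4 _≤ˢ_

  _≤ˢ_ : ∀ {d} → Rel (Subspace d) 0ℓ
  U ≤ˢ W = Member U ⊆ Member W

  subspaces : ℕ → Setoid (ℓsuc 0ℓ) 0ℓ
  subspaces d = On.setoid {B = Subspace d} (≐-setoid (Vec K d) 0ℓ) Member

  infix 4 _≈ˢ_

  _≈ˢ_ : ∀ {d} → Rel (Subspace d) 0ℓ
  _≈ˢ_ {d} = Setoid._≈_ (subspaces d)

  -- Rank is vector space dimension: one more than projective dimension.
  record HasRank {d : ℕ} (W : Subspace d) (r : ℕ) : Set where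
    field
      basis       : Vec (Vec K d) r
      in-W        : All (Member W) basis
      independent : ∀ cs → linComb cs basis ≡ 0ᵛ → cs ≡ 0ᵛ
      spanning    : ∀ v → Member W v → ∃[ cs ] linComb cs basis ≡ v

  points : ℕ → Setoid (ℓsuc 0ℓ) 0ℓ
  points d = subsetoid (subspaces d) (λ W → HasRank W 1)

  Point : ℕ → Set₁
  Point d = Setoid.Carrier (points d)

  infix 4 _on_

  _on_ : ∀ {d} → Point d → Subspace d → Set
  x on W = proj₁ x ≤ˢ W

  -- A polarity is an inclusion-reversing involution of the whole subspace
  -- lattice; no underlying bilinear form is assumed.
  record SymplecticPolarity (d : ℕ) : Set₁ where
    infix 9 _^ζ
    field
      _^ζ        : Subspace d → Subspace d
      reversing  : ∀ {U W} → U ≤ˢ W → W ^ζ ≤ˢ U ^ζ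
      involutive : ∀ W → (W ^ζ) ^ζ ≈ˢ W
      absolute   : ∀ (x : Point d) → x on (proj₁ x ^ζ)

  module _ (e : ℕ) (ζ : SymplecticPolarity (2 * e)) where
    open SymplecticPolarity ζ

    TotallyIsotropic : Pred (Subspace (2 * e)) 0ℓ
    TotallyIsotropic W = W ≤ˢ W ^ζ

    record SymplecticSpread (ℓ : Level) : Set (ℓsuc ℓ ⊔ ℓsuc 0ℓ) where
      field
        Block     : Pred (Subspace (2 * e)) ℓ
        resp      : Block Respects _≈ˢ_
        isotropic : ∀ {W} → Block W → TotallyIsotropic W
        rank      : ∀ {W} → Block W → HasRank W e
        covers    : ∀ (x : Point (2 * e)) → ∃[ W ] Block W × x on W
        disjoint  : ∀ (x : Point (2 * e)) {U W} → Block U → Block W →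
                    x on U → x on W → U ≈ˢ W

    Sp : Graph (ℓsuc 0ℓ) 0ℓ 0ℓ
    Sp = record
      { vertices   = points (2 * e)
      ; Adj        = Adj
      ; adj-resp   = (λ {x} {y} {z} → respʳ {x} {y} {z}) , (λ {y} {x} {z} → respˡ {y} {x} {z})
      ; adj-sym    = λ {x} {y} → symm {x} {y}
      ; adj-irrefl = λ {x} {y} x≈y (x≉y , _) → x≉y x≈y
      }
      where
      module P = Setoid (points (2 * e))
      open P using (_≈_)

      Adj : Rel (Point (2 * e)) 0ℓ
      Adj x y = ¬ (x ≈ y) × y on (proj₁ x ^ζ)

      respʳ : ∀ {x y z} → y ≈ z → Adj x y → Adj x z
      respʳ {x} {y} {z} y≈z (x≉y , y∈x^) =
        (λ x≈z → x≉y (P.trans {x} {z} {y} x≈z (P.sym {y} {z} y≈z))) ,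
        (λ m → y∈x^ (proj₂ y≈z m))

      respˡ : ∀ {y x z} → x ≈ z → Adj x y → Adj z y
      respˡ {y} {x} {z} x≈z (x≉y , y∈x^) =
        (λ z≈y → x≉y (P.trans {x} {z} {y} x≈z z≈y)) ,
        (λ m → reversing {proj₁ z} {proj₁ x} (proj₂ x≈z) (y∈x^ m))

      symm : ∀ {x y} → Adj x y → Adj y x
      symm {x} {y} (x≉y , y∈x^) =
        (λ y≈x → x≉y (P.sym {y} {x} y≈x)) ,
        (λ m → reversing {proj₁ y} {proj₁ x ^ζ} y∈x^ (proj₂ (involutive (proj₁ x)) m))

    module _ {ℓ : Level} (R : SymplecticSpread ℓ) where
      open SymplecticSpread R

      SameBlock : Rel (Point (2 * e)) (ℓsuc 0ℓ ⊔ ℓ)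
      SameBlock x y = ∃[ W ] Block W × x on W × y on W

      Γ : Graph (ℓsuc 0ℓ) 0ℓ (ℓsuc 0ℓ ⊔ ℓ)
      Γ = record
        { vertices   = S.vertices
        ; Adj        = λ x y → S.Adj x y × ¬ SameBlock x y
        ; adj-resp   =
            (λ {x} {y} {z} y≈z (a , ¬s) → proj₁ S.adj-resp {x} {y} {z} y≈z a ,
               (λ (W , b , x∈ , z∈) → ¬s (W , b , x∈ , (λ m → z∈ (proj₁ y≈z m))))) ,
            (λ {y} {x} {z} x≈z (a , ¬s) → proj₂ S.adj-resp {y} {x} {z} x≈z a ,
               (λ (W , b , z∈ , y∈) → ¬s (W , b , (λ m → z∈ (proj₁ x≈z m)) , y∈)))
        ; adj-sym    = λ {x} {y} (a , ¬s) →
            S.adj-sym {x} {y} a , (λ (W , b , y∈ , x∈) → ¬s (W , b , x∈ , y∈))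
        ; adj-irrefl = λ {x} {y} x≈y (a , _) → S.adj-irrefl {x} {y} x≈y a
        }
        where module S = Graph Sp

{-# OPTIONS --safe #-}

-- Counting vectors, a subspace of rank r has q^r elements and a polarity turns it into one with q^(d-r): a polarity
-- reverses covering pairs, and adjoining one vector multiplies the cardinality by q. Since rank r means
-- θ r = (q^r - 1)/(q - 1) points, the polars of a point and of a line have θ (2e - 1) and θ (2e - 2) points, and every
-- block B of the spread satisfies B = B^ζ. The neighbours of x in Γ are the points of x^ζ outside its block B, and B ⊆ x^ζ.
-- The common neighbours of x and y are the points of ⟨x, y⟩^ζ outside their blocks. If x and y share the block B,
-- then B ⊆ ⟨x, y⟩^ζ; otherwise each of the two disjoint blocks meets ⟨x, y⟩^ζ in a subspace of rank e - 1.

module Submission where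

open import Defs
open import Level using (Level; 0ℓ)
open import Algebra.Apartness.Structures using (IsHeytingField)
open import Algebra.Bundles using (CommutativeRing)
import Algebra.Properties.Ring as RingProperties
import Algebra.Solver.Ring.NaturalCoefficients.Default as SemiringSolver
open import Data.Fin.Base using (Fin; combine; remQuot)
open import Data.Fin.Permutation using (↔⇒≡)
import Data.Fin.Properties as Fin
open import Data.List.Base using (List; []; _∷_; length; lookup; filter; tabulate; deduplicate)
open import Data.List.Properties using (length-tabulate)
open import Data.List.Membership.Propositional.Properties using (∈-lookup)
import Data.List.Membership.Setoid as Membership
open import Data.List.Membership.Setoid.Properties
  using (∈-resp-≈; ∈-filter⁺; ∈-tabulate⁺; ∈-deduplicate⁺)
open import Data.List.Relation.Unary.All as All using (All; []; _∷_)
open import Data.List.Relation.Unary.All.Properties using (all-filter)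
  renaming (filter⁺ to All-filter⁺; tabulate⁺ to All-tabulate⁺)
open import Data.List.Relation.Unary.AllPairs using ([]; _∷_)
open import Data.List.Relation.Unary.Any as Any using (index)
open import Data.List.Relation.Unary.Any.Properties using (lookup-index)
open import Data.List.Relation.Unary.Unique.DecSetoid.Properties using (deduplicate-!)
open import Data.List.Relation.Unary.Unique.Setoid using (Unique)
import Data.List.Relation.Unary.Unique.Setoid.Properties as Unique
open import Data.Nat using (ℕ; zero; suc; _+_; _*_; _∸_; _^_; _≥_; _/_; s≤s; z≤n; NonZero; ≢-nonZero⁻¹)
open import Data.Nat.DivMod using (m*n/n≡m)
open import Data.Nat.Properties
  using ( +-comm; +-identityʳ; +-suc; +-cancelˡ-≡; *-comm; *-assoc; *-identityʳ; *-suc; *-cancelˡ-≡; *-cancelʳ-≡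
        ; ^-distribˡ-+-*; m^n≢0; m+[n∸m]≡n; m∸n≢0⇒n<m; <⇒≤)
open import Data.Nat.Solver using (module +-*-Solver)
open import Data.Product.Base using (∃-syntax; _×_; _,_; proj₁; proj₂)
open import Data.Unit.Base using (tt)
open import Data.Vec.Base using (Vec; []; _∷_; head; tail)
open import Data.Vec.Properties using (≡-dec)
import Data.Vec.Relation.Unary.All as VecAll
open import Function.Base using (id; _∘_; _$_)
open import Function.Bundles using (Inverse)
open import Function.Construct.Composition using (inverse)
import Function.Construct.Symmetry as Symmetry
open import Relation.Binary.Bundles using (Setoid; DecSetoid)
import Relation.Binary.Construct.On as On
open import Relation.Binary.Core using (Rel; _Preserves_⟶_)
open import Relation.Binary.Definitions using (_Respects_; DecidableEquality)
open import Relation.Binary.PropositionalEquality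
  using (_≡_; _≢_; refl; sym; trans; cong; cong₂; subst; setoid; module ≡-Reasoning)
open import Relation.Binary.Structures using (IsDecEquivalence)
open import Relation.Nullary using (¬_; Dec; yes; no; contradiction)
import Relation.Nullary.Decidable as Dec
open import Relation.Unary using (Pred; Decidable; U)
open import Relation.Unary.Properties using (∁?)
open Inverse using (to; from; to-cong; from-cong; strictlyInverseˡ; strictlyInverseʳ)

-- Finite cardinalities of setoids, subsets and quotients.

length-filter-∁ : ∀ {a p} {A : Set a} {P : Pred A p} (P? : Decidable P) (xs : List A) →
                  length (filter P? xs) + length (filter (∁? P?) xs) ≡ length xs
length-filter-∁ P? []       = refl
length-filter-∁ P? (x ∷ xs) with P? x
... | yes _ = cong suc (length-filter-∁ P? xs)
... | no  _ = trans (+-suc _ _) (cong suc (length-filter-∁ P? xs))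

private variable
  a b ℓ ℓ₁ ℓ₂ p r : Level
  m n : ℕ

HasSize-unique : {S : Setoid a ℓ} → HasSize S m → HasSize S n → m ≡ n
HasSize-unique I J = ↔⇒≡ (inverse (Symmetry.inverse I) J)

HasSize-transport : {S : Setoid a ℓ₁} {T : Setoid b ℓ₂} → Inverse S T → HasSize T n → HasSize S n
HasSize-transport = inverse

HasSize-resp : {S : Setoid a ℓ} → m ≡ n → HasSize S m → HasSize S n
HasSize-resp {S = S} = subst (HasSize S)

quotient : {A : Set a} {_~_ : Rel A r} → IsDecEquivalence _~_ → Setoid a r
quotient ~-isDecEquivalence = record { isEquivalence = IsDecEquivalence.isEquivalence ~-isDecEquivalence }

module _ (S : Setoid a ℓ) where
  open Setoid S using (_≈_) renaming (Carrier to A)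
  private module S = Setoid S
  open Membership S using (_∈_)

  subsetoid-⇔ : {P : Pred A p} {Q : Pred A r} → (∀ {x} → P x → Q x) → (∀ {x} → Q x → P x) →
                HasSize (subsetoid S P) n → HasSize (subsetoid S Q) n
  subsetoid-⇔ f g = inverse record
    { to        = λ (x , qx) → x , g qx
    ; from      = λ (x , px) → x , f px
    ; to-cong   = id
    ; from-cong = id
    ; inverse   = id , id
    }

  lookup-injective : ∀ {xs} → Unique S xs → ∀ i j → lookup xs i ≈ lookup xs j → i ≡ j
  lookup-injective (_ ∷ _)    Fin.zero    Fin.zero    _  = refl
  lookup-injective (x# ∷ _)   Fin.zero    (Fin.suc j) eq = contradiction eq (All.lookup x# (∈-lookup j))
  lookup-injective (x# ∷ _)   (Fin.suc i) Fin.zero    eq = contradiction (S.sym eq) (All.lookup x# (∈-lookup i))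
  lookup-injective (_ ∷ xs!)  (Fin.suc i) (Fin.suc j) eq = cong Fin.suc (lookup-injective xs! i j eq)

  -- An element is numbered by its position in the list. Uniqueness of the entries makes this
  -- position depend only on the ≈-class, whichever membership proof `complete` returns.
  enumeration⇒HasSize : {P : Pred A p} (xs : List A) → Unique S xs → All P xs →
                        (∀ {x} → P x → x ∈ xs) → HasSize (subsetoid S P) (length xs)
  enumeration⇒HasSize {P = P} xs xs! ps complete = record
    { to        = ix
    ; from      = λ i → lookup xs i , All.lookup ps (∈-lookup i)
    ; to-cong   = λ {x} {y} x≈y → lookup-injective xs! (ix x) (ix y)
                    (S.trans (S.sym (ix-≈ x)) (S.trans x≈y (ix-≈ y)))
    ; from-cong = λ { refl → S.refl }
    ; inverse   = (λ {i} {y} y≈ → lookup-injective xs! (ix y) i (S.trans (S.sym (ix-≈ y)) y≈))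
                , (λ { {x} refl → S.sym (ix-≈ x) })
    }
    where
    ix : ∃[ x ] P x → Fin (length xs)
    ix (_ , px) = index (complete px)

    ix-≈ : ∀ x → proj₁ x ≈ lookup xs (ix x)
    ix-≈ (_ , px) = lookup-index (complete px)

  module _ {P : Pred A p} (I : HasSize (subsetoid S P) n) where

    elements : List A
    elements = tabulate (proj₁ ∘ from I)

    elements-unique : Unique S elements
    elements-unique = Unique.tabulate⁺ S λ {i} {j} eq →
      trans (sym (strictlyInverseˡ I i)) (trans (to-cong I eq) (strictlyInverseˡ I j))

    elements-sound : All P elements
    elements-sound = All-tabulate⁺ (proj₂ ∘ from I)

    elements-complete : ∀ {x} → P x → x ∈ elements
    elements-complete {x} px = ∈-resp-≈ S (strictlyInverseʳ I (x , px)) (∈-tabulate⁺ S (to I (x , px)))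

    module _ {Q : Pred A r} (Q? : Decidable Q) (resp : Q Respects _≈_) where

      HasSize-∩ : ∃[ k ] HasSize (subsetoid S (λ x → P x × Q x)) k
      HasSize-∩ = _ , enumeration⇒HasSize (filter Q? elements)
        (Unique.filter⁺ S Q? elements-unique)
        (All.zip (All-filter⁺ Q? elements-sound , all-filter Q? elements))
        (λ (px , qx) → ∈-filter⁺ S Q? resp (elements-complete px) qx)

      HasSize-∖ : (∀ {x} → Q x → P x) → HasSize (subsetoid S Q) m →
                  ∃[ k ] HasSize (subsetoid S (λ x → P x × ¬ Q x)) k × m + k ≡ n
      HasSize-∖ {m = m} Q⊆P J = _
        , enumeration⇒HasSize (filter (∁? Q?) elements)
            (Unique.filter⁺ S (∁? Q?) elements-unique)
            (All.zip (All-filter⁺ (∁? Q?) elements-sound , all-filter (∁? Q?) elements))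
            (λ (px , ¬qx) → ∈-filter⁺ S (∁? Q?) (λ x≈y ¬qx qy → ¬qx (resp (S.sym x≈y) qy))
                                      (elements-complete px) ¬qx)
        -- The filtered list enumerates `Q`, so its length is the prescribed `m`; the two
        -- complementary filters share out the whole list.
        , trans (cong (_+ length (filter (∁? Q?) elements)) (HasSize-unique J K))
            (trans (length-filter-∁ Q? elements) (length-tabulate (proj₁ ∘ from I)))
        where
        K : HasSize (subsetoid S Q) (length (filter Q? elements))
        K = enumeration⇒HasSize (filter Q? elements) (Unique.filter⁺ S Q? elements-unique)
              (all-filter Q? elements)
              (λ qx → ∈-filter⁺ S Q? resp (elements-complete (Q⊆P qx)) qx)

  HasSize-U : HasSize S n → HasSize (subsetoid S U) n
  HasSize-U = inverse record
    { to = proj₁ ; from = λ x → x , tt ; to-cong = id ; from-cong = id ; inverse = id , id }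

  -- An element is numbered by the pair of its fibre and its place in that fibre. Equivalent `t` may
  -- carry different bijections `J t`, so places are always read off at the canonical representative
  -- `from I i`.
  HasSize-fibres : {T : Setoid b ℓ₂} → HasSize T m → (f : A → Setoid.Carrier T) →
                   f Preserves _≈_ ⟶ Setoid._≈_ T →
                   (∀ t → HasSize (subsetoid S (λ x → Setoid._≈_ T (f x) t)) n) →
                   HasSize S (m * n)
  HasSize-fibres {m = m} {n = n} {T = T} I f f-cong J = record
    { to        = λ x → combine (ix x) (sub x)
    ; from      = λ k → point (remQuot n k)
    ; to-cong   = λ x≈y → let i≡ = to-cong I (f-cong x≈y) in cong₂ combine i≡ (sub-cong i≡ x≈y)
    ; from-cong = λ { refl → S.refl }
    ; inverse   = (λ {k} {y} y≈ → to-point k y y≈) , (λ { {x} refl → from-to x })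
    }
    where
    module T = Setoid T

    ix : A → Fin m
    ix = to I ∘ f

    fibre : ∀ x → f x T.≈ from I (ix x)
    fibre x = T.sym (strictlyInverseʳ I (f x))

    sub : A → Fin n
    sub x = to (J (from I (ix x))) (x , fibre x)

    sub-cong : ∀ {i j x y px py} → i ≡ j → x ≈ y → to (J (from I i)) (x , px) ≡ to (J (from I j)) (y , py)
    sub-cong refl x≈y = to-cong (J _) x≈y

    point : Fin m × Fin n → A
    point (i , j) = proj₁ (from (J (from I i)) j)

    to-point : ∀ k y → y ≈ point (remQuot n k) → combine (ix y) (sub y) ≡ k
    to-point k y y≈ = trans (cong₂ combine i≡ j≡) (Fin.combine-remQuot {m} n k)
      where
      i = proj₁ (remQuot {m} n k)
      j = proj₂ (remQuot {m} n k)
      in-fibre : f (point (i , j)) T.≈ from I i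
      in-fibre = proj₂ (from (J (from I i)) j)
      i≡ : ix y ≡ i
      i≡ = trans (to-cong I (T.trans (f-cong y≈) in-fibre)) (strictlyInverseˡ I i)
      j≡ : sub y ≡ j
      j≡ = trans (sub-cong {py = in-fibre} i≡ y≈) (strictlyInverseˡ (J (from I i)) j)

    from-to : ∀ x → point (remQuot n (combine (ix x) (sub x))) ≈ x
    from-to x = S.trans (S.reflexive (cong point (Fin.remQuot-combine (ix x) (sub x))))
                        (strictlyInverseʳ (J (from I (ix x))) (x , fibre x))

module _ (S : Setoid a ℓ) where
  open Setoid S using (_≈_) renaming (Carrier to A)
  private module S = Setoid S
  open Membership S using (_∈_)

  module _ {_~_ : Rel A r} (~-isDecEquivalence : IsDecEquivalence _~_)
           (≈⇒~ : ∀ {x y} → x ≈ y → x ~ y) where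
    private
      module ~ = IsDecEquivalence ~-isDecEquivalence

      T : DecSetoid a r
      T = record { isDecEquivalence = ~-isDecEquivalence }

      S/~ : Setoid a r
      S/~ = quotient ~-isDecEquivalence

    -- Deleting duplicates up to `~` from a list of all elements leaves one representative per
    -- class. The fibres of the projection to the quotient are the classes, so counting by fibres
    -- relates `k`, `m` and `n`.
    HasSize-quotient : HasSize S n → (∀ x → HasSize (subsetoid S (x ~_)) m) →
                       ∃[ k ] HasSize S/~ k × k * m ≡ n
    HasSize-quotient {n = n} I J = _ , K , HasSize-unique (HasSize-fibres S K id ≈⇒~ L) I
      where
      xs : List A
      xs = tabulate (from I)

      complete : ∀ x → x ∈ xs
      complete x = ∈-resp-≈ S (strictlyInverseʳ I x) (∈-tabulate⁺ S (to I x))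

      K : HasSize S/~ (length (deduplicate ~._≟_ xs))
      K = inverse record { to = λ x → x , tt ; from = proj₁ ; to-cong = id ; from-cong = id ; inverse = id , id }
            (enumeration⇒HasSize S/~ (deduplicate ~._≟_ xs) (deduplicate-! T xs) (All.universal (λ _ → tt) _)
              (λ {x} _ → ∈-deduplicate⁺ S/~ ~._≟_ (λ z~y x~y → ~.trans x~y (~.sym z~y)) (Any.map ≈⇒~ (complete x))))

      L : ∀ t → HasSize (subsetoid S (_~ t)) _
      L t = subsetoid-⇔ S ~.sym ~.sym (J t)

-- Vector arithmetic over a finite field.

module Linear {q : ℕ} (F : FiniteField q) where
  open FiniteField F public renaming (Carrier to K)
  open IsHeytingField isHeytingField
    using (isCommutativeRing; #⇒invertible; invertible⇒#; #-irrefl)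

  private
    K-ring : CommutativeRing 0ℓ 0ℓ
    K-ring = record { isCommutativeRing = isCommutativeRing }

  open CommutativeRing K-ring using (ring; commutativeSemiring; zeroˡ; zeroʳ; *-identityˡ)
    renaming ( +-identityˡ to ⊞-identityˡ; +-identityʳ to ⊞-identityʳ
             ; -‿inverseˡ to ⊞-inverseˡ; -‿inverseʳ to ⊞-inverseʳ; *-assoc to ·-assoc)

  _≟ᴷ_ : DecidableEquality K
  x ≟ᴷ y = Dec.map′ (λ eq → trans (sym (strictlyInverseʳ order x))
                              (trans (cong (from order) eq) (strictlyInverseʳ order y)))
                    (cong (to order)) (to order x Fin.≟ to order y)

  open SemiringSolver commutativeSemiring using (solve; _:+_; _:*_; _:=_)
  open RingProperties ring using (-1*x≈-x; -0#≈0#; -‿involutive)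

  -- If `1# ≡ 0#`, all elements coincide, so `1#` inverts the difference of `0#` with itself, which
  -- makes `0#` apart from itself.
  1≢0 : 1# ≢ 0#
  1≢0 1≡0 = #-irrefl {0#} refl (invertible⇒# (1# , all-equal _ _ , all-equal _ _))
    where
    all-zero : ∀ x → x ≡ 0#
    all-zero x = trans (sym (*-identityˡ x)) (trans (cong (_· x) 1≡0) (zeroˡ x))
    all-equal : ∀ x y → x ≡ y
    all-equal x y = trans (all-zero x) (sym (all-zero y))

  -- The field axioms invert differences of distinct elements, so `c` is read as `c ⊞ - 0#`.
  invertible : ∀ {c} → c ≢ 0# → ∃[ k ] k · c ≡ 1#
  invertible {c} c≢0 = let (k , kc , _) = #⇒invertible c≢0 in
    k , trans (cong (k ·_) (sym (trans (cong (c ⊞_) -0#≈0#) (⊞-identityʳ c)))) kc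

  any? : ∀ {p} {P : Pred K p} → Decidable P → Dec (∃[ c ] P c)
  any? {P = P} P? = Dec.map′ (λ (i , p) → from order i , p)
    (λ (c , p) → to order c , subst P (sym (strictlyInverseʳ order c)) p)
    (Fin.any? (P? ∘ from order))

  infixl 6 _+ᵥ_
  infixl 7 _·ᵥ_

  V : ℕ → Set
  V = Vec K

  _+ᵥ_ : ∀ {d} → V d → V d → V d
  _+ᵥ_ = _+ᵛ_ F

  _·ᵥ_ : ∀ {d} → K → V d → V d
  _·ᵥ_ = _·ᵛ_ F

  0ᵥ : ∀ {d} → V d
  0ᵥ = 0ᵛ F

  _≟ᵥ_ : ∀ {d} → DecidableEquality (V d)
  _≟ᵥ_ = ≡-dec _≟ᴷ_

  ·ᵥ-zeroˡ : ∀ {d} (u : V d) → 0# ·ᵥ u ≡ 0ᵥ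
  ·ᵥ-zeroˡ []      = refl
  ·ᵥ-zeroˡ (x ∷ u) = cong₂ _∷_ (zeroˡ x) (·ᵥ-zeroˡ u)

  ·ᵥ-zeroʳ : ∀ d k → k ·ᵥ 0ᵥ {d} ≡ 0ᵥ
  ·ᵥ-zeroʳ zero    k = refl
  ·ᵥ-zeroʳ (suc d) k = cong₂ _∷_ (zeroʳ k) (·ᵥ-zeroʳ d k)

  ·ᵥ-identityˡ : ∀ {d} (u : V d) → 1# ·ᵥ u ≡ u
  ·ᵥ-identityˡ []      = refl
  ·ᵥ-identityˡ (x ∷ u) = cong₂ _∷_ (*-identityˡ x) (·ᵥ-identityˡ u)

  ·ᵥ-assoc : ∀ {d} k c (u : V d) → (k · c) ·ᵥ u ≡ k ·ᵥ (c ·ᵥ u)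
  ·ᵥ-assoc k c []      = refl
  ·ᵥ-assoc k c (x ∷ u) = cong₂ _∷_ (·-assoc k c x) (·ᵥ-assoc k c u)

  +ᵥ-identityˡ : ∀ {d} (u : V d) → 0ᵥ +ᵥ u ≡ u
  +ᵥ-identityˡ []      = refl
  +ᵥ-identityˡ (x ∷ u) = cong₂ _∷_ (⊞-identityˡ x) (+ᵥ-identityˡ u)

  +ᵥ-comm : ∀ {d} (u v : V d) → u +ᵥ v ≡ v +ᵥ u
  +ᵥ-comm []      []      = refl
  +ᵥ-comm (x ∷ u) (y ∷ v) = cong₂ _∷_ (solve 2 (λ x y → x :+ y := y :+ x) refl x y) (+ᵥ-comm u v)

  -- The solver has coefficients in ℕ, since equality of constants of K does not compute; n stands for a negated scalar.
  +-·-cancelʳ : ∀ {n c} → n ⊞ c ≡ 0# → ∀ x y → (x ⊞ c · y) ⊞ n · y ≡ x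
  +-·-cancelʳ {n} {c} n+c≡0 x y = begin
    (x ⊞ c · y) ⊞ n · y ≡⟨ solve 4 (λ n c x y → (x :+ c :* y) :+ n :* y := x :+ (n :+ c) :* y) refl n c x y ⟩
    x ⊞ (n ⊞ c) · y     ≡⟨ cong (λ k → x ⊞ k · y) n+c≡0 ⟩
    x ⊞ 0# · y          ≡⟨ cong (x ⊞_) (zeroˡ y) ⟩
    x ⊞ 0#              ≡⟨ ⊞-identityʳ x ⟩
    x                   ∎
    where open ≡-Reasoning

  +ᵥ-cancelʳ : ∀ {d} c (w u : V d) → (w +ᵥ c ·ᵥ u) +ᵥ (- c) ·ᵥ u ≡ w
  +ᵥ-cancelʳ c []      []      = refl
  +ᵥ-cancelʳ c (x ∷ w) (y ∷ u) = cong₂ _∷_(+-·-cancelʳ (⊞-inverseˡ c) x y) (+ᵥ-cancelʳ c w u)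

  +ᵥ-cancelʳ- : ∀ {d} c (w u : V d) → (w +ᵥ (- c) ·ᵥ u) +ᵥ c ·ᵥ u ≡ w
  +ᵥ-cancelʳ- c []      []      = refl
  +ᵥ-cancelʳ- c (x ∷ w) (y ∷ u) = cong₂ _∷_(+-·-cancelʳ (⊞-inverseʳ c) x y) (+ᵥ-cancelʳ- c w u)

  translate-+ : ∀ {d} b c (v w u : V d) →
                (v +ᵥ b ·ᵥ u) +ᵥ (w +ᵥ c ·ᵥ u) ≡ (v +ᵥ w) +ᵥ (b ⊞ c) ·ᵥ u
  translate-+ b c []      []      []      = refl
  translate-+ b c (x ∷ v) (y ∷ w) (z ∷ u) = cong₂ _∷_
    (solve 5 (λ b c x y z → (x :+ b :* z) :+ (y :+ c :* z) := (x :+ y) :+ (b :+ c) :* z) refl b c x y z)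
    (translate-+ b c v w u)

  translate-· : ∀ {d} k c (w u : V d) → k ·ᵥ (w +ᵥ c ·ᵥ u) ≡ k ·ᵥ w +ᵥ (k · c) ·ᵥ u
  translate-· k c []      []      = refl
  translate-· k c (x ∷ w) (y ∷ u) = cong₂ _∷_
    (solve 4 (λ k c x y → k :* (x :+ c :* y) := k :* x :+ (k :* c) :* y) refl k c x y) (translate-· k c w u)

  x-x : ∀ x → x ⊞ (- 1#) · x ≡ 0#
  x-x x = trans (cong (x ⊞_) (-1*x≈-x x)) (⊞-inverseʳ x)

  translate-difference : ∀ {d} b c (w u : V d) →
                         (w +ᵥ b ·ᵥ u) +ᵥ (- 1#) ·ᵥ (w +ᵥ c ·ᵥ u) ≡ (b ⊞ - c) ·ᵥ u
  translate-difference b c []      []      = refl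
  translate-difference b c (x ∷ w) (y ∷ u) = cong₂ _∷_
    (begin
      (x ⊞ b · y) ⊞ (- 1#) · (x ⊞ c · y)            ≡⟨ solve 5 (λ n b c x y → (x :+ b :* y) :+ n :* (x :+ c :* y)
                                                         := (x :+ n :* x) :+ (b :+ n :* c) :* y) refl (- 1#) b c x y ⟩
      (x ⊞ (- 1#) · x) ⊞ (b ⊞ (- 1#) · c) · y       ≡⟨ cong₂ _⊞_ (x-x x) (cong (λ k → (b ⊞ k) · y) (-1*x≈-x c)) ⟩
      0# ⊞ (b ⊞ - c) · y                            ≡⟨ ⊞-identityˡ _ ⟩
      (b ⊞ - c) · y                                 ∎)
    (translate-difference b c w u)
    where
    open ≡-Reasoning

  +ᵥ-inverse : ∀ {d} (u : V d) → u +ᵥ (- 1#) ·ᵥ u ≡ 0ᵥ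
  +ᵥ-inverse []      = refl
  +ᵥ-inverse (x ∷ u) = cong₂ _∷_ (x-x x) (+ᵥ-inverse u)

  translate-0 : ∀ {d} (w u : V d) → w +ᵥ 0# ·ᵥ u ≡ w
  translate-0 w u = trans (cong (w +ᵥ_) (·ᵥ-zeroˡ u)) (trans (+ᵥ-comm w 0ᵥ) (+ᵥ-identityˡ w))

  ·ᵥ-cancelˡ : ∀ {d} {c} → c ≢ 0# → ∃[ k ] (∀ (u : V d) → k ·ᵥ (c ·ᵥ u) ≡ u)
  ·ᵥ-cancelˡ {c = c} c≢0 = let (k , kc≡1) = invertible c≢0 in
    k , λ u → trans (sym (·ᵥ-assoc k c u)) (trans (cong (_·ᵥ u) kc≡1) (·ᵥ-identityˡ u))

  HasSize-V : ∀ d → HasSize (setoid (V d)) (q ^ d)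
  HasSize-V zero    = record
    { to = λ _ → Fin.zero ; from = λ _ → [] ; to-cong = λ _ → refl ; from-cong = λ _ → refl
    ; inverse = (λ { {Fin.zero} _ → refl }) , λ { {[]} _ → refl } }
  HasSize-V (suc d) = HasSize-fibres _ order head (cong head) λ c →
    HasSize-transport
      record
        { to        = λ (v , _) → tail v
        ; from      = λ v → c ∷ v , refl
        ; to-cong   = cong tail
        ; from-cong = cong (c ∷_)
        ; inverse   = (λ { refl → refl }) , λ { {(x ∷ v) , refl} refl → refl }
        }
      (HasSize-V d)

  -- Subspaces, spans and their cardinalities.

  module _ {d : ℕ} where

    Sub : Set₁
    Sub = Subspace F d

    infix 4 _∈_ _∈?_ _⊑_ _≅_
    _∈_ : V d → Sub → Set
    v ∈ W = Member W v

    _∈?_ : ∀ v W → Dec (v ∈ W)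
    v ∈? W = Subspace.member? W v

    _⊑_ : Sub → Sub → Set
    _⊑_ = _≤ˢ_ F

    _≅_ : Sub → Sub → Set
    _≅_ = _≈ˢ_ F

    0∈ : ∀ W → 0ᵥ ∈ W
    0∈ = Subspace.0-closed

    ∈-resp : ∀ W {u v} → u ≡ v → u ∈ W → v ∈ W
    ∈-resp W = subst (_∈ W)

    +-∈ : ∀ W {u v} → u ∈ W → v ∈ W → u +ᵥ v ∈ W
    +-∈ = Subspace.+-closed

    ·-∈ : ∀ W c {v} → v ∈ W → c ·ᵥ v ∈ W
    ·-∈ = Subspace.·-closed

    elementsOf : Sub → Setoid 0ℓ 0ℓ
    elementsOf W = subsetoid (setoid (V d)) (Member W)

    abstract
      -- Sealed, because any bijection with some `Fin n` determines the number; no argument depends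
      -- on how it is computed.
      card′ : (W : Sub) → ∃[ n ] HasSize (elementsOf W) n
      card′ W =
        let n , I = HasSize-∩ (setoid (V d)) (HasSize-U _ (HasSize-V d)) (_∈? W) (subst (_∈ W))
        in n , subsetoid-⇔ _ proj₂ (tt ,_) I

    card : Sub → ℕ
    card W = proj₁ (card′ W)

    HasSize-card : ∀ W → HasSize (elementsOf W) (card W)
    HasSize-card W = proj₂ (card′ W)

    card-unique : ∀ W {n} → HasSize (elementsOf W) n → card W ≡ n
    card-unique W = HasSize-unique (HasSize-card W)

    card-cong : ∀ {U W} → U ≅ W → card U ≡ card W
    card-cong {U} {W} (U⊑W , W⊑U) = card-unique U (subsetoid-⇔ _ W⊑U U⊑W (HasSize-card W))

    zeroSub : Sub
    zeroSub = record
      { Member = _≡ 0ᵥ ; member? = _≟ᵥ 0ᵥ ; 0-closed = refl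
      ; +-closed = λ { refl refl → +ᵥ-identityˡ 0ᵥ }
      ; ·-closed = λ { c refl → ·ᵥ-zeroʳ d c } }

    card-zeroSub : card zeroSub ≡ 1
    card-zeroSub = card-unique zeroSub record
      { to = λ _ → Fin.zero ; from = λ _ → 0ᵥ , refl ; to-cong = λ _ → refl ; from-cong = λ _ → refl
      ; inverse = (λ { {Fin.zero} _ → refl }) , λ { {_ , refl} _ → refl } }

    ⊤Sub : Sub
    ⊤Sub = record { Member = U ; member? = λ _ → yes tt ; 0-closed = tt ; +-closed = λ _ _ → tt ; ·-closed = λ _ _ → tt }

    card-⊤Sub : card ⊤Sub ≡ q ^ d
    card-⊤Sub = card-unique ⊤Sub (HasSize-U _ (HasSize-V d))

    infixl 8 _∩ˢ_
    _∩ˢ_ : Sub → Sub → Sub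
    U ∩ˢ W = record
      { Member   = λ v → v ∈ U × v ∈ W
      ; member?  = λ v → (v ∈? U) Dec.×-dec (v ∈? W)
      ; 0-closed = 0∈ U , 0∈ W
      ; +-closed = λ (a , b) (a′ , b′) → +-∈ U a a′ , +-∈ W b b′
      ; ·-closed = λ c (a , b) → ·-∈ U c a , ·-∈ W c b
      }

    -- This is the subspace generated by `W` and `u`. Asking for a scalar that moves `v` into `W`
    -- makes membership decidable by a search through the field; `c` is the negative of the
    -- coefficient of `u` in `v`.
    adjoin : Sub → V d → Sub
    adjoin W u = record
      { Member   = λ v → ∃[ c ] v +ᵥ c ·ᵥ u ∈ W
      ; member?  = λ v → any? (λ c → v +ᵥ c ·ᵥ u ∈? W)
      ; 0-closed = 0# , ∈-resp W (sym (translate-0 0ᵥ u)) (0∈ W)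
      ; +-closed = λ (b , v∈) (c , w∈) → b ⊞ c , ∈-resp W (translate-+ b c _ _ u) (+-∈ W v∈ w∈)
      ; ·-closed = λ k (c , w∈) → k · c , ∈-resp W (translate-· k c _ u) (·-∈ W k w∈)
      }

    ⊑-adjoin : ∀ W u → W ⊑ adjoin W u
    ⊑-adjoin W u w∈ = 0# , ∈-resp W (sym (translate-0 _ u)) w∈

    ∈-adjoin : ∀ W u → u ∈ adjoin W u
    ∈-adjoin W u = - 1# , ∈-resp W (sym (+ᵥ-inverse u)) (0∈ W)

    adjoin-⊑ : ∀ W {u} X → W ⊑ X → u ∈ X → adjoin W u ⊑ X
    adjoin-⊑ W {u} X W⊑X u∈X (c , w∈) = ∈-resp X (+ᵥ-cancelʳ c _ u) (+-∈ X (W⊑X w∈) (·-∈ X (- c) u∈X))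

    -- Subtracting the two vectors leaves `(b ⊞ - c) ·ᵥ u` in `W`. For `b ≢ c` the scalar is
    -- invertible, which would put `u` into `W`.
    adjoin-coefficient-unique : ∀ {W u} → ¬ u ∈ W → ∀ {v b c} →
                                v +ᵥ b ·ᵥ u ∈ W → v +ᵥ c ·ᵥ u ∈ W → b ≡ c
    adjoin-coefficient-unique {W} {u} u∉W {v} {b} {c} b∈ c∈ with b ≟ᴷ c
    ... | yes b≡c = b≡c
    ... | no  b≢c = contradiction u∈W u∉W
      where
      k = proj₁ (#⇒invertible b≢c)
      u∈W : u ∈ W
      u∈W = ∈-resp W (trans (sym (·ᵥ-assoc k (b ⊞ - c) u))
                       (trans (cong (_·ᵥ u) (proj₁ (proj₂ (#⇒invertible b≢c)))) (·ᵥ-identityˡ u)))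
              (·-∈ W k (∈-resp W (translate-difference b c v u) (+-∈ W b∈ (·-∈ W (- 1#) c∈))))

    -- The coefficient of `u` fibres the larger space over the field, and each fibre is a translate
    -- of `W`.
    card-adjoin : ∀ W {u} → ¬ u ∈ W → card (adjoin W u) ≡ q * card W
    card-adjoin W {u} u∉W = card-unique (adjoin W u) $
      HasSize-fibres (elementsOf (adjoin W u)) {T = setoid K} order (λ (_ , c , _) → c)
        -- Elements are compared by their vectors alone, so the coefficient has to be shown to
        -- depend only on the vector.
        (λ { {_ , b , b∈} {_ , c , c∈} refl → adjoin-coefficient-unique {W} u∉W b∈ c∈ })
        λ c → HasSize-transport {T = elementsOf W}
          record
            { to        = λ { ((v , .c , v∈) , refl) → v +ᵥ c ·ᵥ u , v∈ }
            ; from      = λ (v , v∈) →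
                (v +ᵥ (- c) ·ᵥ u , c , ∈-resp W (sym (+ᵥ-cancelʳ- c v u)) v∈) , refl
            ; to-cong   = λ { {(_ , _ , _) , refl} {(_ , _ , _) , refl} refl → refl }
            ; from-cong = λ { refl → refl }
            ; inverse   = (λ { {v , _} {(_ , _ , _) , refl} refl → +ᵥ-cancelʳ- c v u })
                        , (λ { {(v , _ , _) , refl} refl → +ᵥ-cancelʳ c v u })
            }
          (HasSize-card W)

    card-∖ : ∀ {U W} → U ⊑ W →
             ∃[ k ] HasSize (subsetoid (setoid (V d)) (λ v → v ∈ W × ¬ v ∈ U)) k × card U + k ≡ card W
    card-∖ {U} {W} U⊑W = HasSize-∖ _ (HasSize-card W) (_∈? U) (subst (_∈ U)) U⊑W (HasSize-card U)

    -- The complement of `U` in `W` has cardinality 0, so a vector of `W` outside `U` would yield an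
    -- element of `Fin 0`.
    ⊑∧card≡⇒⊒ : ∀ {U W} → U ⊑ W → card U ≡ card W → W ⊑ U
    ⊑∧card≡⇒⊒ {U} {W} U⊑W eq {v} v∈W with v ∈? U | card-∖ {U} {W} U⊑W
    ... | yes v∈U | _          = v∈U
    ... | no  v∉U | k , I , eq′ = contradiction (to I′ (v , v∈W , v∉U)) λ ()
      where
      I′ = HasSize-resp (+-cancelˡ-≡ (card U) k 0 (trans eq′ (trans (sym eq) (sym (+-identityʳ _))))) I

    -- A search through the finite vector space turns the failure of an inclusion into a witness
    -- constructively.
    ⋢⇒∃ : ∀ U W → ¬ U ⊑ W → ∃[ v ] v ∈ U × ¬ v ∈ W
    ⋢⇒∃ U W U⋢W with Fin.any? (λ i → let v = from (HasSize-V d) i in (v ∈? U) Dec.×-dec Dec.¬? (v ∈? W))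
    ... | yes (i , v∈U , v∉W) = _ , v∈U , v∉W
    ... | no  none = contradiction (λ {v} v∈U → Dec.decidable-stable (v ∈? W) λ v∉W →
            none (to I v , ∈-resp U (sym (strictlyInverseʳ I v)) v∈U
                         , v∉W ∘ ∈-resp W (strictlyInverseʳ I v))) U⋢W
      where I = HasSize-V d

    lc : ∀ {r} → V r → Vec (V d) r → V d
    lc = linComb F

    span : ∀ {r} → Vec (V d) r → Sub
    span []       = zeroSub
    span (b ∷ bs) = adjoin (span bs) b

    lc∈ : ∀ {r} W (cs : V r) {bs} → VecAll.All (_∈ W) bs → lc cs bs ∈ W
    lc∈ W []       VecAll.[]            = 0∈ W
    lc∈ W (c ∷ cs) (b∈ VecAll.∷ bs∈) = +-∈ W (·-∈ W c b∈) (lc∈ W cs bs∈)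

    span⇒lc : ∀ {r} (bs : Vec (V d) r) {v} → v ∈ span bs → ∃[ cs ] lc cs bs ≡ v
    span⇒lc []       refl     = [] , refl
    span⇒lc (b ∷ bs) {v} (c , v∈) = let cs , eq = span⇒lc bs v∈ in
      -- The sign flips because `c` records that `v +ᵥ c ·ᵥ b` lies in the span of the tail.
      - c ∷ cs , trans (cong ((- c) ·ᵥ b +ᵥ_) eq) (trans (+ᵥ-comm _ _) (+ᵥ-cancelʳ c v b))

    basis⊑span : ∀ {r} (bs : Vec (V d) r) → VecAll.All (_∈ span bs) bs
    basis⊑span []       = VecAll.[]
    basis⊑span (b ∷ bs) = ∈-adjoin (span bs) b VecAll.∷ VecAll.map (⊑-adjoin (span bs) b) (basis⊑span bs)

    span-⊑ : ∀ {r} W {bs : Vec (V d) r} → VecAll.All (_∈ W) bs → span bs ⊑ W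
    span-⊑ W VecAll.[]            refl = 0∈ W
    span-⊑ W {b ∷ bs} (b∈ VecAll.∷ bs∈) = adjoin-⊑ (span bs) W (span-⊑ W bs∈) b∈

    Independent : ∀ {r} → Vec (V d) r → Set
    Independent bs = ∀ cs → lc cs bs ≡ 0ᵥ → cs ≡ 0ᵥ

    independent-tail : ∀ {r b} {bs : Vec (V d) r} → Independent (b ∷ bs) → Independent bs
    independent-tail {b = b} {bs} ind cs eq = cong tail (ind (0# ∷ cs)
      (trans (cong (_+ᵥ lc cs bs) (·ᵥ-zeroˡ b)) (trans (+ᵥ-identityˡ _) eq)))

    -- If `b` were a combination of `bs`, prefixing the coefficient `- 1#` would give a vanishing
    -- combination; independence then forces `- 1#` to be zero.
    independent-head : ∀ {r b} {bs : Vec (V d) r} → Independent (b ∷ bs) → ¬ b ∈ span bs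
    independent-head {b = b} {bs} ind b∈ = 1≢0 $ begin
      1#               ≡⟨ sym $ -‿involutive 1# ⟩
      - (- 1#)         ≡⟨ cong (-_ ∘ head) (ind (- 1# ∷ cs) dependency) ⟩
      - 0#             ≡⟨ -0#≈0# ⟩
      0#               ∎
      where
      open ≡-Reasoning
      cs = proj₁ (span⇒lc bs b∈)
      dependency : (- 1#) ·ᵥ b +ᵥ lc cs bs ≡ 0ᵥ
      dependency = trans (cong ((- 1#) ·ᵥ b +ᵥ_) (proj₂ (span⇒lc bs b∈))) (trans (+ᵥ-comm _ _) (+ᵥ-inverse b))

    span-basis : ∀ {r W} (h : HasRank F W r) → span (HasRank.basis h) ≅ W
    span-basis {W = W} h = span-⊑ W in-W , λ v∈ →
      let cs , eq = spanning _ v∈ in ∈-resp (span basis) eq (lc∈ (span basis) cs (basis⊑span basis))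
      where open HasRank h

    card-span : ∀ {r} (bs : Vec (V d) r) → Independent bs → card (span bs) ≡ q ^ r
    card-span []       ind = card-zeroSub
    card-span (b ∷ bs) ind = trans (card-adjoin (span bs) (independent-head ind))
                                   (cong (q *_) (card-span bs (independent-tail ind)))

    card-rank : ∀ {r W} → HasRank F W r → card W ≡ q ^ r
    card-rank h = trans (sym (card-cong {span (HasRank.basis h)} (span-basis h)))
                        (card-span (HasRank.basis h) (HasRank.independent h))

-- Projective points and their number in a subspace.

module Projective {q : ℕ} (F : FiniteField q) {d : ℕ} where
  open Linear F
  private module ≅ = Setoid (subspaces F d)

  ⟨_⟩ : V d → Sub
  ⟨ v ⟩ = span (v ∷ [])

  ⟨⟩-⊑ : ∀ {v} W → v ∈ W → ⟨ v ⟩ ⊑ W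
  ⟨⟩-⊑ W v∈W = span-⊑ W (v∈W VecAll.∷ VecAll.[])

  ∈-⟨⟩ : ∀ v → v ∈ ⟨ v ⟩
  ∈-⟨⟩ = ∈-adjoin zeroSub

  independent-singleton : ∀ {v : V d} → v ≢ 0ᵥ → Independent (v ∷ [])
  independent-singleton {v} v≢0 (c ∷ []) eq with c ≟ᴷ 0#
  ... | yes refl = refl
  ... | no c≢0 =
    let k , kc = ·ᵥ-cancelˡ c≢0
        cv≡0 = trans (trans (sym (+ᵥ-identityˡ _)) (+ᵥ-comm _ _)) eq
    in contradiction (trans (sym (kc v)) (trans (cong (k ·ᵥ_) cv≡0) (·ᵥ-zeroʳ d k))) v≢0

  card-⟨⟩ : ∀ {v} → v ≢ 0ᵥ → card ⟨ v ⟩ ≡ q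
  card-⟨⟩ {v} v≢0 = trans (card-span (v ∷ []) (independent-singleton v≢0)) (*-identityʳ q)

  -- One line is included in the other and both have `q` vectors.
  ∈-⟨⟩⇒≅ : ∀ {v w} → v ≢ 0ᵥ → w ≢ 0ᵥ → w ∈ ⟨ v ⟩ → ⟨ v ⟩ ≅ ⟨ w ⟩
  ∈-⟨⟩⇒≅ {v} {w} v≢0 w≢0 w∈ =
    ⊑∧card≡⇒⊒ {U = ⟨ w ⟩} {⟨ v ⟩} w⊑v (trans (card-⟨⟩ w≢0) (sym (card-⟨⟩ v≢0))) , w⊑v
    where
    w⊑v : ⟨ w ⟩ ⊑ ⟨ v ⟩
    w⊑v = ⟨⟩-⊑ ⟨ v ⟩ w∈

  Pt : Set₁
  Pt = Point F d

  sub : Pt → Sub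
  sub = proj₁

  gen : Pt → V d
  gen (_ , h) = head (HasRank.basis h)

  ⟨gen⟩ : ∀ x → ⟨ gen x ⟩ ≅ sub x
  ⟨gen⟩ (_ , h@record { basis = _ ∷ [] }) = span-basis h

  gen≢0 : ∀ x → gen x ≢ 0ᵥ
  gen≢0 (_ , h@record { basis = _ ∷ [] }) = independent-head (HasRank.independent h)

  gen∈ : ∀ x → gen x ∈ sub x
  gen∈ x = proj₁ (⟨gen⟩ x) (∈-⟨⟩ (gen x))

  -- Reduces incidence to one membership test on the generator, which is what makes incidence
  -- decidable.
  ∈⇒on : ∀ x W → gen x ∈ W → sub x ⊑ W
  ∈⇒on x W g∈ v∈ = ⟨⟩-⊑ W g∈ (proj₂ (⟨gen⟩ x) v∈)

  on? : ∀ x W → Dec (sub x ⊑ W)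
  on? x W = Dec.map′ (λ g∈ {v} → ∈⇒on x W g∈ {v}) (λ x⊑W → x⊑W (gen∈ x)) (gen x ∈? W)

  gen∈⇒≈ : ∀ x y → gen y ∈ sub x → sub x ≅ sub y
  gen∈⇒≈ x y g∈ = ≅.trans {sub x} {⟨ gen x ⟩} {sub y} (≅.sym {⟨ gen x ⟩} {sub x} (⟨gen⟩ x))
    (≅.trans {⟨ gen x ⟩} {⟨ gen y ⟩} {sub y} (∈-⟨⟩⇒≅ (gen≢0 x) (gen≢0 y) (proj₂ (⟨gen⟩ x) g∈)) (⟨gen⟩ y))

  point : ∀ v → v ≢ 0ᵥ → Pt
  point v v≢0 = ⟨ v ⟩ , record
    { basis       = v ∷ []
    ; in-W        = basis⊑span (v ∷ [])
    ; independent = independent-singleton v≢0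
    ; spanning    = λ _ → span⇒lc (v ∷ [])
    }

  On : Sub → Setoid _ _
  On W = subsetoid (points F d) (λ x → sub x ⊑ W)

  zeroSub-⊑ : ∀ (W : Subspace F d) → zeroSub ⊑ W
  zeroSub-⊑ W refl = 0∈ W

  NonZeroIn : Sub → Setoid _ _
  NonZeroIn W = subsetoid (setoid (V d)) (λ v → v ∈ W × v ≢ 0ᵥ)

  -- A point is a class of q - 1 nonzero vectors spanning the same line.
  HasSize-On : ∀ W → ∃[ n ] HasSize (On W) n × suc (n * (q ∸ 1)) ≡ card W
  HasSize-On W = size , HasSize-transport vectors HasSize-~ , trans (cong suc size*[q∸1]≡) 1+k≡
    where
    nonzero = card-∖ {U = zeroSub} {W} (zeroSub-⊑ W)
    k = proj₁ nonzero
    1+k≡ : suc k ≡ card W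
    1+k≡ = trans (cong (_+ k) (sym card-zeroSub)) (proj₂ (proj₂ nonzero))

    A : Set
    A = Setoid.Carrier (NonZeroIn W)

    _~_ : A → A → Set
    (v , _) ~ (w , _) = ⟨ v ⟩ ≅ ⟨ w ⟩

    ≡⇒~ : ∀ {x y : A} → proj₁ x ≡ proj₁ y → x ~ y
    ≡⇒~ {v , _} refl = ≅.refl {⟨ v ⟩}

    ~-isDecEquivalence : IsDecEquivalence _~_
    ~-isDecEquivalence = record
      { isEquivalence = On.isEquivalence (λ (v , _) → ⟨ v ⟩) ≅.isEquivalence
      ; _≟_ = λ (v , _ , v≢0) (w , _ , w≢0) →
          Dec.map′ (∈-⟨⟩⇒≅ v≢0 w≢0) (λ eq → proj₂ eq (∈-⟨⟩ w)) (w ∈? ⟨ v ⟩)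
      }

    class-size : ∀ x → HasSize (subsetoid (NonZeroIn W) (x ~_)) (q ∸ 1)
    class-size (v , v∈W , v≢0) =
      let k , I , eq = card-∖ {U = zeroSub} {⟨ v ⟩} (zeroSub-⊑ ⟨ v ⟩) in
      -- Exactly one of the `q` vectors of the line is zero, so `1 + k = q`.
      HasSize-resp (cong (_∸ 1) (trans (cong (_+ k) (sym card-zeroSub)) (trans eq (card-⟨⟩ v≢0)))) $
      HasSize-transport record
        { to        = λ ((w , _ , w≢0) , v~w) → w , proj₂ v~w (∈-⟨⟩ w) , w≢0
        ; from      = λ (w , w∈ , w≢0) → (w , ⟨⟩-⊑ W v∈W w∈ , w≢0) , ∈-⟨⟩⇒≅ v≢0 w≢0 w∈
        ; to-cong   = id
        ; from-cong = id
        ; inverse   = id , id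
        } I

    ~-quotient = HasSize-quotient (NonZeroIn W) ~-isDecEquivalence (λ {x} {y} → ≡⇒~ {x} {y})
                   (proj₁ (proj₂ nonzero)) class-size
    size = proj₁ ~-quotient
    HasSize-~ = proj₁ (proj₂ ~-quotient)
    size*[q∸1]≡ = proj₂ (proj₂ ~-quotient)

    vectors : Inverse (On W) (quotient ~-isDecEquivalence)
    vectors = record
      { to        = λ (x , x⊑W) → gen x , x⊑W (gen∈ x) , gen≢0 x
      ; from      = λ (v , v∈W , v≢0) → point v v≢0 , ⟨⟩-⊑ W v∈W
      ; to-cong   = λ {(x , _)} {(y , _)} → gen-cong x (sub y) {⟨ gen y ⟩} (≅.sym {⟨ gen y ⟩} {sub y} (⟨gen⟩ y))
      ; from-cong = id
      ; inverse   = (λ {(v , _)} {(y , _)} y≈v → ≅.trans {⟨ gen y ⟩} {sub y} {⟨ v ⟩} (⟨gen⟩ y) y≈v)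
                  , (λ {(x , _)} {(v , _)} v~x → ≅.trans {⟨ v ⟩} {⟨ gen x ⟩} {sub x} v~x (⟨gen⟩ x))
      }
      where
      gen-cong : ∀ x Y {Z} → Y ≅ Z → sub x ≅ Y → ⟨ gen x ⟩ ≅ Z
      gen-cong x Y {Z} Y≅Z x≅Y = ≅.trans {⟨ gen x ⟩} {sub x} {Z} (⟨gen⟩ x) (≅.trans {sub x} {Y} {Z} x≅Y Y≅Z)

-- Cardinalities of polar subspaces.

module Polar {q : ℕ} (F : FiniteField q) {d : ℕ} (ζ : SymplecticPolarity F d) where
  open Linear F
  open Projective F {d}
  open SymplecticPolarity ζ

  reverse : ∀ U W → U ⊑ W → W ^ζ ⊑ U ^ζ
  reverse U W = reversing {U} {W}

  ⊑-ζζ : ∀ W → W ⊑ (W ^ζ) ^ζ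
  ⊑-ζζ W = proj₂ (involutive W)

  ζζ-⊑ : ∀ W → (W ^ζ) ^ζ ⊑ W
  ζζ-⊑ W = proj₁ (involutive W)

  -- Reversing the hypothesis gives that the double polar of `W` lies in `U ^ζ`, and `W` lies in its
  -- double polar: the polarity is a Galois connection with itself.
  galois : ∀ U W → U ⊑ W ^ζ → W ⊑ U ^ζ
  galois U W U⊑ = reverse U (W ^ζ) U⊑ ∘ ⊑-ζζ W

  -- For t in W ^ζ but not in Y, the polar of Y + ⟨ t ⟩ lies between W and W + ⟨ u ⟩, a covering pair, so it is W.
  card-ζ-adjoin : ∀ W {u} → ¬ u ∈ W → card (W ^ζ) ≡ q * card (adjoin W u ^ζ)
  card-ζ-adjoin W {u} u∉W = trans (card-cong {U = W ^ζ} {X} (W^⊑X , X⊑W^)) (card-adjoin Y t∉Y)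
    where
    W+u = adjoin W u
    Y = W+u ^ζ
    Y⊑W^ : Y ⊑ W ^ζ
    Y⊑W^ = reverse W W+u (⊑-adjoin W u)
    -- Otherwise `W+u` would lie in the double polar of `W`, which is `W`, and so would `u`.
    W^⋢Y : ¬ W ^ζ ⊑ Y
    W^⋢Y W^⊑Y = u∉W (ζζ-⊑ W (galois (W ^ζ) W+u W^⊑Y (∈-adjoin W u)))
    witness = ⋢⇒∃ (W ^ζ) Y W^⋢Y
    t = proj₁ witness
    t∉Y = proj₂ (proj₂ witness)
    X = adjoin Y t
    X⊑W^ : X ⊑ W ^ζ
    X⊑W^ = adjoin-⊑ Y (W ^ζ) Y⊑W^ (proj₁ (proj₂ witness))
    W⊑X^ : W ⊑ X ^ζ
    W⊑X^ = galois X W X⊑W^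
    X^⊑W+u : X ^ζ ⊑ W+u
    X^⊑W+u v∈ = ζζ-⊑ W+u (reverse Y X (⊑-adjoin Y t) v∈)
    -- With `u` also `W+u` would lie in `X ^ζ`, hence `X` in `Y`, against the choice of `t`.
    u∉X^ : ¬ u ∈ X ^ζ
    u∉X^ u∈ = t∉Y (galois W+u X (adjoin-⊑ W (X ^ζ) W⊑X^ u∈) (∈-adjoin Y t))
    X^⊑W : X ^ζ ⊑ W
    X^⊑W {s} s∈ with X^⊑W+u s∈
    -- Here `s +ᵥ c ·ᵥ u` lies in `W`, hence in `X ^ζ` like `s`. If `c` is nonzero, subtracting `s`
    -- and dividing by `c` would put `u` into `X ^ζ`.
    ... | c , w∈ with c ≟ᴷ 0#
    ...   | yes refl = ∈-resp W (translate-0 s u) w∈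
    ...   | no  c≢0  = contradiction u∈X^ u∉X^
      where
      c·u∈ : c ·ᵥ u ∈ X ^ζ
      c·u∈ = ∈-resp (X ^ζ) (trans (cong (_+ᵥ (- 1#) ·ᵥ s) (+ᵥ-comm s (c ·ᵥ u)))
               (trans (cong (λ z → (c ·ᵥ u +ᵥ z) +ᵥ (- 1#) ·ᵥ s) (sym (·ᵥ-identityˡ s))) (+ᵥ-cancelʳ 1# (c ·ᵥ u) s)))
               (+-∈ (X ^ζ) (W⊑X^ w∈) (·-∈ (X ^ζ) (- 1#) s∈))
      u∈X^ : u ∈ X ^ζ
      u∈X^ = let k , kc = ·ᵥ-cancelˡ c≢0 in ∈-resp (X ^ζ) (kc u) (·-∈ (X ^ζ) k c·u∈)
    W^⊑X : W ^ζ ⊑ X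
    W^⊑X v∈ = ζζ-⊑ X (reverse (X ^ζ) W X^⊑W v∈)

  -- The zero subspace lies in the polar of the whole space, so by `galois` the whole space lies in
  -- the polar of zero.
  card-zeroSub-ζ : card (zeroSub ^ζ) ≡ q ^ d
  card-zeroSub-ζ = trans
    (card-cong {U = zeroSub ^ζ} {⊤Sub} ((λ _ → tt) , galois zeroSub ⊤Sub (zeroSub-⊑ (⊤Sub ^ζ)))) card-⊤Sub

  -- Each further independent vector divides the cardinality of the polar by `q`; the product form
  -- keeps the induction free of division.
  card-ζ-span : ∀ {r} (bs : Vec (V d) r) → Independent bs → card (span bs ^ζ) * q ^ r ≡ q ^ d
  card-ζ-span []       ind = trans (*-identityʳ _) card-zeroSub-ζ
  card-ζ-span {suc r} (b ∷ bs) ind = begin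
    card (span (b ∷ bs) ^ζ) * (q * q ^ r) ≡⟨ *-assoc (card (span (b ∷ bs) ^ζ)) q (q ^ r) ⟨
    card (span (b ∷ bs) ^ζ) * q * q ^ r   ≡⟨ cong (_* q ^ r) (*-comm (card (span (b ∷ bs) ^ζ)) q) ⟩
    q * card (span (b ∷ bs) ^ζ) * q ^ r   ≡⟨ cong (_* q ^ r) (card-ζ-adjoin (span bs) (independent-head ind)) ⟨
    card (span bs ^ζ) * q ^ r             ≡⟨ card-ζ-span bs (independent-tail ind) ⟩
    q ^ d                                 ∎
    where open ≡-Reasoning

  card-ζ-rank : ∀ {r W} → HasRank F W r → card (W ^ζ) * q ^ r ≡ q ^ d
  card-ζ-rank {r} {W} h = trans (cong (_* q ^ r) (card-cong {U = W ^ζ} {span bs ^ζ}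
      (reverse (span bs) W (proj₁ eq) , reverse W (span bs) (proj₂ eq))))
    (card-ζ-span bs (HasRank.independent h))
    where
    bs = HasRank.basis h
    eq = span-basis h

-- Arithmetic of the numbers of points of subspaces.

module GaussianNumbers (q : ℕ) .{{_ : NonZero (q ∸ 1)}} where
  θ : ℕ → ℕ
  θ r = (q ^ r ∸ 1) / (q ∸ 1)

  q≡ : suc (q ∸ 1) ≡ q
  q≡ = m+[n∸m]≡n (<⇒≤ (m∸n≢0⇒n<m {q} {1} (≢-nonZero⁻¹ (q ∸ 1))))

  instance
    q-nonZero : NonZero q
    q-nonZero = subst NonZero q≡ _

  q^≢0 : ∀ r → NonZero (q ^ r)
  q^≢0 r = m^n≢0 q r

  -- Point counts arrive in this multiplicative form; the division in `θ` is then exact and returns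
  -- `n`.
  θ-unique : ∀ {n} r → suc (n * (q ∸ 1)) ≡ q ^ r → n ≡ θ r
  θ-unique {n} r eq = trans (sym (m*n/n≡m n (q ∸ 1))) (cong (λ m → (m ∸ 1) / (q ∸ 1)) eq)

  -- Horner's recursion for `1 + q + ... + q ^ (r - 1)`. It supplies the exact quotient behind
  -- `θ-spec`.
  repunit : ∀ r → ∃[ n ] suc (n * (q ∸ 1)) ≡ q ^ r
  repunit zero    = 0 , refl
  repunit (suc r) = let n , eq = repunit r in 1 + q * n , (begin
    suc ((1 + q * n) * k)       ≡⟨ cong (λ p → suc ((1 + p * n) * k)) q≡ ⟨
    suc ((1 + suc k * n) * k)   ≡⟨ solve 2 (λ k n → con 1 :+ (con 1 :+ (con 1 :+ k) :* n) :* k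
                                      := (con 1 :+ k) :* (con 1 :+ n :* k)) refl k n ⟩
    suc k * suc (n * k)         ≡⟨ cong₂ _*_ q≡ eq ⟩
    q * q ^ r                   ∎)
    where
    open ≡-Reasoning
    open +-*-Solver
    k = q ∸ 1

  θ-spec : ∀ r → suc (θ r * (q ∸ 1)) ≡ q ^ r
  θ-spec r = let n , eq = repunit r in trans (cong (λ m → suc (m * (q ∸ 1))) (sym (θ-unique {n} r eq))) eq

  -- Rests on `q^(r+s) - 1 = (q^r - 1) + q^r (q^s - 1)`. Removing a subspace of rank `r` from one of
  -- rank `r + s` thus leaves `q ^ r * θ s` points.
  θ-+ : ∀ r s → θ (r + s) ≡ θ r + q ^ r * θ s
  θ-+ r s = sym $ θ-unique (r + s) $ begin
    suc ((θ r + q ^ r * θ s) * k)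
      ≡⟨ solve 4 (λ t p u k → con 1 :+ (t :+ p :* u) :* k := (con 1 :+ t :* k) :+ p :* (u :* k))
           refl (θ r) (q ^ r) (θ s) k ⟩
    suc (θ r * k) + q ^ r * (θ s * k) ≡⟨ cong (_+ q ^ r * (θ s * k)) (θ-spec r) ⟩
    q ^ r + q ^ r * (θ s * k)         ≡⟨ *-suc (q ^ r) (θ s * k) ⟨
    q ^ r * suc (θ s * k)             ≡⟨ cong (q ^ r *_) (θ-spec s) ⟩
    q ^ r * q ^ s                     ≡⟨ ^-distribˡ-+-* q r s ⟨
    q ^ (r + s)                       ∎
    where
    open ≡-Reasoning
    open +-*-Solver
    k = q ∸ 1

  -- Allows the block size to be cancelled when the blocks are counted.
  θ-suc-nonZero : ∀ r → NonZero (θ (suc r))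
  θ-suc-nonZero r = subst NonZero (sym (trans (θ-+ 1 r) (cong (_+ q ^ 1 * θ r) θ-1))) _
    where
    θ-1 : θ 1 ≡ 1
    θ-1 = sym (θ-unique 1 (trans (cong suc (+-identityʳ (q ∸ 1))) (trans q≡ (sym (*-identityʳ q)))))

-- Blocks of the spread and neighbourhoods in the graph.

module Spread {ℓ : Level} {q : ℕ} .{{_ : NonZero (q ∸ 1)}} (F : FiniteField q) (f : ℕ)
              (ζ : SymplecticPolarity F (2 * (2 + f))) (R : SymplecticSpread F (2 + f) ζ ℓ) where

  e d : ℕ
  e = 2 + f
  d = 2 * e

  open GaussianNumbers q
  open Linear F
  open Projective F {d}
  open Polar F ζ
  open SymplecticPolarity ζ
  open SymplecticSpread R

  _≈ₚ_ : Pt → Pt → Set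
  x ≈ₚ y = sub x ≅ sub y

  HasSize-θ : ∀ r W → card W ≡ q ^ r → HasSize (On W) (θ r)
  HasSize-θ r W eq = let n , I , eq′ = HasSize-On W in HasSize-resp (θ-unique {n} r (trans eq′ eq)) I

  card-ζ : ∀ {r s W} → HasRank F W r → r + s ≡ d → card (W ^ζ) ≡ q ^ s
  card-ζ {r} {s} {W} h r+s≡d = *-cancelʳ-≡ (card (W ^ζ)) (q ^ s) (q ^ r) {{q^≢0 r}} $ begin
    card (W ^ζ) * q ^ r ≡⟨ card-ζ-rank h ⟩
    q ^ d               ≡⟨ cong (q ^_) r+s≡d ⟨
    q ^ (r + s)         ≡⟨ ^-distribˡ-+-* q r s ⟩
    q ^ r * q ^ s       ≡⟨ *-comm (q ^ r) (q ^ s) ⟩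
    q ^ s * q ^ r       ∎
    where open ≡-Reasoning

  infix 9 _^⊥
  _^⊥ : Pt → Sub
  x ^⊥ = sub x ^ζ

  -- The exponent is `d - 1`, split as `e + suc f` so that removing a block becomes an instance of
  -- `θ-+`.
  card-⊥ : ∀ x → card (x ^⊥) ≡ q ^ (e + suc f)
  card-⊥ (X , h) = card-ζ h (trans (sym (+-suc e (suc f))) (cong (e +_) (sym (+-identityʳ e))))

  block : Pt → Sub
  block x = proj₁ (covers x)

  block-Block : ∀ x → Block (block x)
  block-Block x = proj₁ (proj₂ (covers x))

  on-block : ∀ x → sub x ⊑ block x
  on-block x = proj₂ (proj₂ (covers x))

  block-unique : ∀ x {W} → Block W → sub x ⊑ W → W ≅ block x
  block-unique x bW x⊑W = disjoint x bW (block-Block x) x⊑W (on-block x)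

  _∼_ : Pt → Pt → Set _
  _∼_ = SameBlock F e ζ R

  -- Only one block passes through `x`, so any block shared with `y` is `block x`. This trades the
  -- existential over blocks for a decidable incidence.
  ∼⇒on-block : ∀ x y → x ∼ y → sub y ⊑ block x
  ∼⇒on-block x y (W , bW , x⊑W , y⊑W) y∈ = proj₁ (block-unique x {W} bW x⊑W) (y⊑W y∈)

  on-block⇒∼ : ∀ x y → sub y ⊑ block x → x ∼ y
  on-block⇒∼ x y y⊑ = block x , block-Block x , on-block x , y⊑

  ∼-sym : ∀ {x y} → x ∼ y → y ∼ x
  ∼-sym (W , bW , x⊑W , y⊑W) = W , bW , y⊑W , x⊑W

  ∼-trans : ∀ {x y z} → x ∼ y → y ∼ z → x ∼ z
  ∼-trans {x} {y} {z} (W , bW , x⊑W , y⊑W) y∼z = W , bW , x⊑W ,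
    λ z∈ → proj₂ (block-unique y {W} bW y⊑W) (∼⇒on-block y z y∼z z∈)

  ≈⇒∼ : ∀ {x y} → x ≈ₚ y → x ∼ y
  ≈⇒∼ {x} {y} x≈y = on-block⇒∼ x y (λ y∈ → on-block x (proj₂ x≈y y∈))

  ∼-isDecEquivalence : IsDecEquivalence _∼_
  ∼-isDecEquivalence = record
    { isEquivalence = record
      { refl  = λ {x} → on-block⇒∼ x x (on-block x)
      ; sym   = λ {x} {y} → ∼-sym {x} {y}
      ; trans = λ {x} {y} {z} → ∼-trans {x} {y} {z}
      }
    ; _≟_ = λ x y → Dec.map′ (on-block⇒∼ x y) (∼⇒on-block x y) (on? y (block x))
    }

  card-block : ∀ x → card (block x) ≡ q ^ e
  card-block x = card-rank (rank (block-Block x))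

  block-⊑-ζ : ∀ x → block x ⊑ block x ^ζ
  block-⊑-ζ x = isotropic (block-Block x)

  -- A block is contained in its polar, and both have `q ^ e` vectors because `d - e = e`.
  ζ-⊑-block : ∀ x → block x ^ζ ⊑ block x
  ζ-⊑-block x = ⊑∧card≡⇒⊒ {U = block x} {block x ^ζ} (block-⊑-ζ x)
    (trans (card-block x) (sym (card-ζ (rank (block-Block x)) (cong (e +_) (sym (+-identityʳ e))))))

  -- As `y` lies on the block, the polar of the block lies in `y ^⊥`; an isotropic block lies in its
  -- own polar.
  block-⊑-⊥ : ∀ {x y} → x ∼ y → block x ⊑ y ^⊥
  block-⊑-⊥ {x} {y} x∼y b∈ = reverse (sub y) (block x) (∼⇒on-block x y x∼y) (block-⊑-ζ x b∈)

  ∼-refl : ∀ x → x ∼ x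
  ∼-refl x = on-block⇒∼ x x (on-block x)

  HasSize-block : ∀ x → HasSize (subsetoid (points F d) (x ∼_)) (θ e)
  HasSize-block x = subsetoid-⇔ (points F d) (λ {y} → on-block⇒∼ x y) (λ {y} → ∼⇒on-block x y)
    (HasSize-θ e (block x) (card-block x))

  HasSize-points : HasSize (points F d) (θ d)
  HasSize-points = HasSize-transport {T = On ⊤Sub}
    record { to = λ x → x , λ _ → tt ; from = proj₁ ; to-cong = id ; from-cong = id ; inverse = id , id }
    (HasSize-θ d ⊤Sub card-⊤Sub)

  -- The size `k` of the difference is prescribed through a sum and identified by cancelling `θ r`,
  -- which keeps truncated subtraction out of the counts.
  HasSize-On-∖ : ∀ {p n k} (P : Pred Pt p) W r → card W ≡ q ^ r → (∀ x → sub x ⊑ W → P x) →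
                 HasSize (subsetoid (points F d) P) n → θ r + k ≡ n →
                 HasSize (subsetoid (points F d) (λ x → P x × ¬ sub x ⊑ W)) k
  HasSize-On-∖ P W r eq W⊆P I n≡ =
    let k , J , k≡ = HasSize-∖ (points F d) I (λ x → on? x W) (λ x≈y x⊑W y∈ → x⊑W (proj₂ x≈y y∈))
                       (λ {x} → W⊆P x) (HasSize-θ r W eq)
    in HasSize-resp (+-cancelˡ-≡ (θ r) _ _ (trans k≡ (sym n≡))) J

  Γ-adj⇒ : ∀ {x z} → Graph.Adj (Γ F e ζ R) x z → sub z ⊑ x ^⊥ × ¬ sub z ⊑ block x
  Γ-adj⇒ {x} {z} ((_ , z⊑x⊥) , x≁z) = z⊑x⊥ , x≁z ∘ on-block⇒∼ x z

  -- The distinctness demanded by adjacency follows from the second hypothesis, since a point equal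
  -- to `x` lies on the block of `x`.
  ⇒Γ-adj : ∀ {x z} → sub z ⊑ x ^⊥ → ¬ sub z ⊑ block x → Graph.Adj (Γ F e ζ R) x z
  ⇒Γ-adj {x} {z} z⊑x⊥ z⋢ = ((λ x≈z → z⋢ (∼⇒on-block x z (≈⇒∼ {x} {z} x≈z))) , z⊑x⊥) , z⋢ ∘ ∼⇒on-block x z

  HasSize-neighbours : ∀ x → HasSize (Graph.Neighbours (Γ F e ζ R) x) (q ^ e * θ (suc f))
  HasSize-neighbours x = subsetoid-⇔ (points F d)
    (λ {z} (z⊑ , z⋢) → ⇒Γ-adj {x} {z} z⊑ z⋢) (λ {z} → Γ-adj⇒ {x} {z}) $
    HasSize-On-∖ (λ z → sub z ⊑ x ^⊥) (block x) e (card-block x) (λ z z⊑ z∈ → block-⊑-⊥ {x} {x} (∼-refl x) (z⊑ z∈))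
      (HasSize-θ (e + suc f) (x ^⊥) (card-⊥ x)) (sym (θ-+ e (suc f)))

  -- Common neighbours of two points.

  join : Pt → Pt → Sub
  join x y = adjoin (sub x) (gen y)

  join-⊑ : ∀ x y W → sub x ⊑ W → sub y ⊑ W → join x y ⊑ W
  join-⊑ x y W x⊑ y⊑ = adjoin-⊑ (sub x) W x⊑ (y⊑ (gen∈ y))

  -- Together with `join-ζ-⊑ˡ` and `join-ζ-⊑ʳ` this identifies the polar of the join with the
  -- intersection of the polars of `x` and `y`.
  ⊑-join-ζ : ∀ x y W → W ⊑ x ^⊥ → W ⊑ y ^⊥ → W ⊑ join x y ^ζ
  ⊑-join-ζ x y W W⊑x W⊑y = galois (join x y) W
    (join-⊑ x y (W ^ζ) (galois W (sub x) W⊑x) (galois W (sub y) W⊑y))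

  join-ζ-⊑ˡ : ∀ x y → join x y ^ζ ⊑ x ^⊥
  join-ζ-⊑ˡ x y = reverse (sub x) (join x y) (⊑-adjoin (sub x) (gen y))

  join-ζ-⊑ʳ : ∀ x y → join x y ^ζ ⊑ y ^⊥
  join-ζ-⊑ʳ x y = reverse (sub y) (join x y) (∈⇒on y (join x y) (∈-adjoin (sub x) (gen y)))

  -- Distinctness keeps `gen y` out of `x`, so adjoining it divides the cardinality of `x ^⊥` by
  -- `q`.
  card-join-ζ : ∀ x y → ¬ x ≈ₚ y → card (join x y ^ζ) ≡ q ^ (e + f)
  card-join-ζ x y x≉y = *-cancelˡ-≡ (card (join x y ^ζ)) (q ^ (e + f)) q $ begin
    q * card (join x y ^ζ) ≡⟨ card-ζ-adjoin (sub x) (x≉y ∘ gen∈⇒≈ x y) ⟨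
    card (x ^⊥)            ≡⟨ card-⊥ x ⟩
    q ^ (e + suc f)        ≡⟨ cong (q ^_) (+-suc e f) ⟩
    q * q ^ (e + f)        ∎
    where open ≡-Reasoning

  HasSize-join-ζ : ∀ x y → ¬ x ≈ₚ y → HasSize (On (join x y ^ζ)) (θ (e + f))
  HasSize-join-ζ x y x≉y = HasSize-θ (e + f) (join x y ^ζ) (card-join-ζ x y x≉y)

  HasSize-common-same : ∀ x y → ¬ x ≈ₚ y → x ∼ y →
                        HasSize (Graph.CommonNeighbours (Γ F e ζ R) x y) (q ^ e * θ f)
  HasSize-common-same x y x≉y x∼y = subsetoid-⇔ (points F d)
    (λ {z} (z⊑ , z⋢) →
        ⇒Γ-adj {x} {z} (λ z∈ → join-ζ-⊑ˡ x y (z⊑ z∈)) z⋢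
      , ⇒Γ-adj {y} {z} (λ z∈ → join-ζ-⊑ʳ x y (z⊑ z∈))
          -- The blocks of `x` and `y` coincide, so avoiding one means avoiding the other.
          (λ z⊑by → z⋢ (∼⇒on-block x z (∼-trans {x} {y} {z} x∼y (on-block⇒∼ y z z⊑by)))))
    (λ {z} (xz , yz) → let z⊑x⊥ , z⋢ = Γ-adj⇒ {x} {z} xz ; z⊑y⊥ , _ = Γ-adj⇒ {y} {z} yz in
        ⊑-join-ζ x y (sub z) z⊑x⊥ z⊑y⊥ , z⋢) $
    HasSize-On-∖ (λ z → sub z ⊑ join x y ^ζ) (block x) e (card-block x)
      (λ z z⊑ z∈ → ⊑-join-ζ x y (block x) (block-⊑-⊥ {x} {x} (∼-refl x)) (block-⊑-⊥ {x} {y} x∼y) (z⊑ z∈))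
      (HasSize-join-ζ x y x≉y) (sym (θ-+ e f))

  -- Since block x is its own polar, it lies in y ^⊥ only if it contains y.
  card-block∩⊥ : ∀ x y → ¬ x ∼ y → card (block x ∩ˢ y ^⊥) ≡ q ^ suc f
  card-block∩⊥ x y x≁y = *-cancelˡ-≡ (card N) (q ^ suc f) q $ begin
    q * card N                  ≡⟨ card-adjoin N {u} (u∉y⊥ ∘ proj₂) ⟨
    card (adjoin N u)           ≡⟨ card-cong {U = adjoin N u} {B} (adjoin-⊑ N B proj₁ u∈B , B⊑N+u) ⟩
    card B                      ≡⟨ card-block x ⟩
    q ^ e                       ∎
    where
    open ≡-Reasoning
    B = block x
    N = B ∩ˢ y ^⊥
    B⋢y⊥ : ¬ B ⊑ y ^⊥
    B⋢y⊥ B⊑ = x≁y (on-block⇒∼ x y (λ y∈ → ζ-⊑-block x (galois B (sub y) B⊑ y∈)))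
    witness = ⋢⇒∃ B (y ^⊥) B⋢y⊥
    u = proj₁ witness
    u∈B = proj₁ (proj₂ witness)
    u∉y⊥ = proj₂ (proj₂ witness)
    y⊥+u = adjoin (y ^⊥) u
    -- `y ^⊥` is a hyperplane, so one vector outside it generates the whole space with it.
    card-y⊥+u : card y⊥+u ≡ card ⊤Sub
    card-y⊥+u = begin
      card y⊥+u             ≡⟨ card-adjoin (y ^⊥) u∉y⊥ ⟩
      q * card (y ^⊥)       ≡⟨ cong (q *_) (card-⊥ y) ⟩
      q ^ (1 + (e + suc f)) ≡⟨ cong (q ^_) (trans (sym (+-suc e (suc f))) (cong (e +_) (sym (+-identityʳ e)))) ⟩
      q ^ d                 ≡⟨ card-⊤Sub ⟨
      card ⊤Sub             ∎
    -- An instance of the modular law: some `v +ᵥ c ·ᵥ u` lies in `y ^⊥`, and it stays in `B`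
    -- because `u` does.
    B⊑N+u : B ⊑ adjoin N u
    B⊑N+u v∈B =
      let c , v+cu∈ = ⊑∧card≡⇒⊒ {U = y⊥+u} {⊤Sub} (λ _ → tt) card-y⊥+u tt
      in c , +-∈ B v∈B (·-∈ B c u∈B) , v+cu∈

  -- With `t = θ (suc f)` and `k = q ∸ 1` the quotient is `t * k * t`, and `t + t * k * t` is
  -- `q ^ suc f * t`; `θ-+` for two halves of rank `suc f` finishes.
  λ₂≡ : θ (suc f) + (θ (suc f) + (q ^ suc f ∸ 1) ^ 2 / (q ∸ 1)) ≡ θ (e + f)
  λ₂≡ = begin
    t + (t + (q ^ suc f ∸ 1) ^ 2 / k)       ≡⟨ cong (λ p → t + (t + (p ∸ 1) ^ 2 / k)) (θ-spec (suc f)) ⟨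
    t + (t + (t * k) ^ 2 / k)               ≡⟨ cong (λ p → t + (t + p / k)) (solve 2 (λ t k → (t :* k) :^ 2 := (t :* k :* t) :* k) refl t k) ⟩
    t + (t + (t * k * t) * k / k)           ≡⟨ cong (λ p → t + (t + p)) (m*n/n≡m (t * k * t) k) ⟩
    t + suc (t * k) * t                     ≡⟨ cong (λ p → t + p * t) (θ-spec (suc f)) ⟩
    t + q ^ suc f * t                       ≡⟨ θ-+ (suc f) (suc f) ⟨
    θ (suc f + suc f)                       ≡⟨ cong θ (+-suc (suc f) f) ⟩
    θ (e + f)                               ∎
    where
    open ≡-Reasoning
    open +-*-Solver
    t = θ (suc f)
    k = q ∸ 1

  -- Inside the polar of the join, lying on the block of `x` amounts to lying on `N`, and likewise
  -- for `y` and `N′`. The two are removed in turn.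
  HasSize-common-distinct : ∀ x y → ¬ x ∼ y →
                            HasSize (Graph.CommonNeighbours (Γ F e ζ R) x y) ((q ^ suc f ∸ 1) ^ 2 / (q ∸ 1))
  HasSize-common-distinct x y x≁y = subsetoid-⇔ (points F d)
    (λ {z} ((z⊑ , z⋢N) , z⋢N′) →
      let z⊑x⊥ : sub z ⊑ x ^⊥
          z⊑x⊥ = λ z∈ → join-ζ-⊑ˡ x y (z⊑ z∈)
          z⊑y⊥ : sub z ⊑ y ^⊥
          z⊑y⊥ = λ z∈ → join-ζ-⊑ʳ x y (z⊑ z∈)
      in ⇒Γ-adj {x} {z} z⊑x⊥ (λ z⊑bx → z⋢N (λ z∈ → z⊑bx z∈ , z⊑y⊥ z∈))
       , ⇒Γ-adj {y} {z} z⊑y⊥ (λ z⊑by → z⋢N′ (λ z∈ → z⊑by z∈ , z⊑x⊥ z∈)))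
    (λ {z} (xz , yz) → let z⊑x⊥ , z⋢bx = Γ-adj⇒ {x} {z} xz ; z⊑y⊥ , z⋢by = Γ-adj⇒ {y} {z} yz in
        (⊑-join-ζ x y (sub z) z⊑x⊥ z⊑y⊥ , (λ z⊑N → z⋢bx (λ z∈ → proj₁ (z⊑N z∈))))
      , (λ z⊑N′ → z⋢by (λ z∈ → proj₁ (z⊑N′ z∈)))) $
    HasSize-On-∖ (λ z → sub z ⊑ join x y ^ζ × ¬ sub z ⊑ N) N′ (suc f) (card-block∩⊥ y x y≁x) (λ z z⊑N′ →
        (λ z∈ → ⊑-join-ζ x y N′ proj₂ (λ v∈ → block-⊑-⊥ {y} {y} (∼-refl y) (proj₁ v∈)) (z⊑N′ z∈))
      -- A point on both `N` and `N′` would put `x` and `y` into the same block.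
      , (λ z⊑N → x≁y (∼-trans {x} {z} {y} (on-block⇒∼ x z (λ z∈ → proj₁ (z⊑N z∈)))
                         (∼-sym {y} {z} (on-block⇒∼ y z (λ z∈ → proj₁ (z⊑N′ z∈)))))))
      (HasSize-On-∖ (λ z → sub z ⊑ join x y ^ζ) N (suc f) (card-block∩⊥ x y x≁y)
        (λ z z⊑N z∈ → ⊑-join-ζ x y N (λ v∈ → block-⊑-⊥ {x} {x} (∼-refl x) (proj₁ v∈)) proj₂ (z⊑N z∈))
        (HasSize-join-ζ x y (x≁y ∘ ≈⇒∼ {x} {y})) λ₂≡)
      -- `λ₂≡` already prescribes the count after removing `N` as `θ (suc f)` plus the final one.
      refl
    where
    N N′ : Sub
    N  = block x ∩ˢ y ^⊥
    N′ = block y ∩ˢ x ^⊥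
    y≁x : ¬ y ∼ x
    y≁x = x≁y ∘ ∼-sym {y} {x}

  -- The partition into blocks and the resulting design.

  abstract
    -- All classes have `θ e` points, and `d = e + e` gives `θ d = θ e + q ^ e * θ e`; cancelling
    -- `θ e` yields the number of classes.
    HasSize-classes : HasSize (quotient ∼-isDecEquivalence) (q ^ e + 1)
    HasSize-classes =
      let m , K , m*θe≡θd = HasSize-quotient (points F d) ∼-isDecEquivalence (λ {x} {y} → ≈⇒∼ {x} {y})
                              HasSize-points HasSize-block
      in HasSize-resp (*-cancelʳ-≡ m (q ^ e + 1) (θ e) {{θ-suc-nonZero (suc f)}} (trans m*θe≡θd θd≡)) K
      where
      open ≡-Reasoning
      θd≡ : θ d ≡ (q ^ e + 1) * θ e
      θd≡ = begin
        θ d                 ≡⟨ cong (λ n → θ (e + n)) (+-identityʳ e) ⟩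
        θ (e + e)           ≡⟨ θ-+ e e ⟩
        suc (q ^ e) * θ e   ≡⟨ cong (_* θ e) (+-comm (q ^ e) 1) ⟨
        (q ^ e + 1) * θ e   ∎

  class : Pt → Fin (q ^ e + 1)
  class = to HasSize-classes

  rep : Fin (q ^ e + 1) → Pt
  rep = from HasSize-classes

  rep∼ : ∀ x → rep (class x) ∼ x
  rep∼ = strictlyInverseʳ HasSize-classes

  class-rep : ∀ i → class (rep i) ≡ i
  class-rep = strictlyInverseˡ HasSize-classes

  ∼⇒class : ∀ x y → x ∼ y → class x ≡ class y
  ∼⇒class x y = to-cong HasSize-classes {x} {y}

  class⇒∼ : ∀ x y → class x ≡ class y → x ∼ y
  class⇒∼ x y eq = ∼-trans {x} {rep (class x)} {y} (∼-sym {rep (class x)} {x} (rep∼ x))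
    (subst (λ i → rep i ∼ y) (sym eq) (rep∼ y))

  HasSize-class : ∀ i → HasSize (subsetoid (points F d) (λ x → class x ≡ i)) (θ e)
  HasSize-class i = subsetoid-⇔ (points F d)
    (λ {x} rep∼x → trans (sym (∼⇒class (rep i) x rep∼x)) (class-rep i))
    (λ {x} eq → class⇒∼ (rep i) x (trans (class-rep i) (sym eq)))
    (HasSize-block (rep i))

  isDivisibleDesignGraph : IsDivisibleDesignGraph (Γ F e ζ R)
    (θ d) (q ^ e * θ (suc f)) (q ^ e * θ f) ((q ^ suc f ∸ 1) ^ 2 / (q ∸ 1)) (q ^ e + 1) (θ e)
  isDivisibleDesignGraph = record
    { order          = HasSize-points
    ; regular        = HasSize-neighbours
    ; class          = class
    ; class-cong     = λ {x} {y} x≈y → ∼⇒class x y (≈⇒∼ {x} {y} x≈y)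
    ; class-size     = HasSize-class
    ; same-class     = λ x y x≉y eq → HasSize-common-same x y x≉y (class⇒∼ x y eq)
    ; distinct-class = λ x y neq → HasSize-common-distinct x y (neq ∘ ∼⇒class x y)
    }

theorem6 : ∀ {ℓ : Level} (q e : ℕ) (q-pp : PrimePower q) → e ≥ 2 →
    (F : FiniteField q) (ζ : SymplecticPolarity F (2 * e)) (R : SymplecticSpread F e ζ ℓ) →
    let instance
          q∸1-nonZero : NonZero (q ∸ 1)
          q∸1-nonZero = primePower⇒q∸1-nonZero q-pp
    in
    IsDivisibleDesignGraph (Γ F e ζ R)
      ((q ^ (2 * e) ∸ 1) / (q ∸ 1))
      (q ^ e * ((q ^ (e ∸ 1) ∸ 1) / (q ∸ 1)))
      (q ^ e * ((q ^ (e ∸ 2) ∸ 1) / (q ∸ 1)))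
      ((q ^ (e ∸ 1) ∸ 1) ^ 2 / (q ∸ 1))
      (q ^ e + 1)
      ((q ^ e ∸ 1) / (q ∸ 1))
-- Writing `e` as `2 + f` lets `e ∸ 1` and `e ∸ 2` compute to `suc f` and `f`.
theorem6 q (suc (suc f)) q-pp (s≤s (s≤s z≤n)) F ζ R =
  Spread.isDivisibleDesignGraph {{primePower⇒q∸1-nonZero q-pp}} F f ζ R
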